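{- Let $D\ge2$, and let MOO ("Move Only Outwards") be any lazy and local deterministic online algorithm for the infinite server problem on layered graphs that moves servers along edges only in the direction away from the source. Then the competitive ratio of MOO on layered graphs of depth $D$ is exactly $D-\frac12$: on every layered graph of depth $D$ it is $(D-\frac12)$-competitive, and for every $\rho<D-\frac12$ there is a layered graph of depth $D$ on which it is not $\rho$-competitive.
   Context: A layered graph of depth $D$ is a graph whose (possibly infinitely many) nodes are arranged in layers $0,1,\dots,D$ such that all edges run between adjacent layers, layer $0$ consists of a single node, and every node other than that one is adjacent to at least one node of the previous layer. Its metric is the shortest-path (number of edges) distance; the single node of layer $0$ is the source. Infinite server problem: an unbounded number of servers initially reside at the source; a finite sequence of requests (nodes) is revealed one by one; each must be served immediately, without knowledge of future requests, by moving a server to it; the cost is the total distance traveled. An algorithm is lazy if it moves only one server to serve a request at an unoccupied point and moves no server if the requested point is already occupied. It is local if it moves a server from $a$ to $b$ only when there is no server at some other point $c$ with $d(a,b)=d(a,c)+d(c,b)$. An online algorithm is $\rho$-competitive if $ALG(\sigma)\le\rho\,OPT(\sigma)+c$ for all $\sigma$, with $c$ independent of $\sigma$; its competitive ratio is the infimum of such $\rho$. -}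

module Defs where

open import Data.Bool using (if_then_else_)
open import Data.Integer using (+_)
open import Data.List using (List; []; _∷_)
open import Data.Nat using (ℕ; suc; _+_; _≤_; _≡ᵇ_)
open import Data.Product using (Σ-syntax; ∃-syntax; _×_; _,_)
open import Data.Rational as ℚ using (ℚ)
open import Data.Sum using (_⊎_)
open import Data.Unit using (⊤)
open import Level using (0ℓ)
open import Relation.Binary using (Rel; Symmetric)
open import Relation.Binary.Construct.Closure.ReflexiveTransitive using (Star)
open import Relation.Binary.PropositionalEquality using (_≡_; _≢_)
open import Relation.Nullary using (¬_)

data Walk {V : Set} (E : Rel V 0ℓ) : V → V → ℕ → Set where
  stop : ∀ {u} → Walk E u u 0
  step : ∀ {u v w n} → E u v → Walk E v w n → Walk E u w (suc n)

-- The graph comes with its shortest-path metric.  Any two nodes are joined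
-- through the source by a walk of length at most 2 D, so classically dist exists
-- and is uniquely determined by the other fields; constructively, it makes
-- distances computable and equality of nodes decidable.
record LayeredGraph (D : ℕ) : Set₁ where
  field
    Node          : Set
    Adj           : Rel Node 0ℓ
    Adj-sym       : Symmetric Adj
    layer         : Node → ℕ
    layer≤D       : ∀ v → layer v ≤ D
    Adj-layers    : ∀ {u v} → Adj u v →
                    layer v ≡ suc (layer u) ⊎ layer u ≡ suc (layer v)
    source        : Node
    layer-source  : layer source ≡ 0
    source-unique : ∀ v → layer v ≡ 0 → v ≡ source
    parent        : ∀ v → v ≢ source →
                    ∃[ u ] (Adj u v × layer v ≡ suc (layer u))
    dist          : Node → Node → ℕ
    dist-walk     : ∀ u v → Walk Adj u v (dist u v)
    dist-minimal  : ∀ {u v n} → Walk Adj u v n → dist u v ≤ n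

  AwayEdge : Rel Node 0ℓ
  AwayEdge u v = Adj u v × layer v ≡ suc (layer u)

module InfiniteServer {D : ℕ} (G : LayeredGraph D) where
  open LayeredGraph G

  -- The unboundedly many servers are numbered by ℕ.
  Config : Set
  Config = ℕ → Node

  initial : Config
  initial _ = source

  Occupied : Config → Node → Set
  Occupied C v = ∃[ i ] C i ≡ v

  -- (i , v) sends server i to v.
  Move : Set
  Move = ℕ × Node

  move : Config → Move → Config
  move C (i , v) j = if i ≡ᵇ j then v else C j

  -- The moves of a list are carried out from left to right.
  moves : Config → List Move → Config
  moves C []       = C
  moves C (m ∷ ms) = moves (move C m) ms

  cost : Config → List Move → ℕ
  cost C []             = 0
  cost C ((i , v) ∷ ms) = dist (C i) v + cost (move C (i , v)) ms

  EachMove : (Config → Move → Set) → Config → List Move → Set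
  EachMove P C []       = ⊤
  EachMove P C (m ∷ ms) = P C m × EachMove P (move C m) ms

  -- Request sequences are listed latest request first.
  Requests : Set
  Requests = List Node

  -- Schedule σ C n: σ can be served, request by request, at total cost n,
  -- leaving the servers in configuration C.
  data Schedule : Requests → Config → ℕ → Set where
    start : Schedule [] initial 0
    serve : ∀ {σ r C n} → Schedule σ C n →
            (ms : List Move) → Occupied (moves C ms) r →
            Schedule (r ∷ σ) (moves C ms) (n + cost C ms)

  IsOPT : Requests → ℕ → Set
  IsOPT σ n = (∃[ C ] Schedule σ C n) × (∀ {C m} → Schedule σ C m → n ≤ m)

  -- What an algorithm has done after the requests σ, when it answers the
  -- request r arriving after σ by the moves respond σ r.
  configOf : (Requests → Node → List Move) → Requests → Config
  configOf respond []      = initial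
  configOf respond (r ∷ σ) = moves (configOf respond σ) (respond σ r)

  costOf : (Requests → Node → List Move) → Requests → ℕ
  costOf respond []      = 0
  costOf respond (r ∷ σ) =
    costOf respond σ + cost (configOf respond σ) (respond σ r)

  record OnlineAlgorithm : Set where
    field
      respond : Requests → Node → List Move
      serves  : ∀ σ r → Occupied (configOf respond (r ∷ σ)) r

    config : Requests → Config
    config = configOf respond

    ALG : Requests → ℕ
    ALG = costOf respond

  module _ (A : OnlineAlgorithm) where
    open OnlineAlgorithm A

    Lazy : Set
    Lazy = ∀ σ r →
      (Occupied (config σ) r → respond σ r ≡ []) ×
      (¬ Occupied (config σ) r → ∃[ i ] respond σ r ≡ (i , r) ∷ [])

    LocalMove : Config → Move → Set
    LocalMove C (i , b) = ∀ j → C j ≢ C i → C j ≢ b →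
      dist (C i) b ≢ dist (C i) (C j) + dist (C j) b

    Local : Set
    Local = ∀ σ r → EachMove LocalMove (config σ) (respond σ r)

    -- A walk consisting of outward edges is automatically a shortest one,
    -- so it is what the server is charged for.
    OutwardMove : Config → Move → Set
    OutwardMove C (i , b) = Star AwayEdge (C i) b

    OnlyOutward : Set
    OnlyOutward = ∀ σ r → EachMove OutwardMove (config σ) (respond σ r)

    record IsMOO : Set where
      field
        lazy    : Lazy
        local   : Local
        outward : OnlyOutward

    Competitive : ℚ → Set
    Competitive ρ = Σ[ c ∈ ℚ ] (∀ σ opt → IsOPT σ opt →
      (+ ALG σ ℚ./ 1) ℚ.≤ ρ ℚ.* (+ opt ℚ./ 1) ℚ.+ c)

open InfiniteServer public using (OnlineAlgorithm; IsMOO; Competitive)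

{-# OPTIONS --safe #-}

-- Upper bound.  Since every request is also served by OPT, MOO never occupies
-- a node that OPT did not pay to reach.  Charge twice its layer to every node
-- occupied by MOO or OPT, plus one for every server of OPT strictly between
-- the source and layer D: a move of length d increases the charge by at most
-- (2 D − 1) d, and the layers of the nodes occupied by MOO add up to its cost.
--
-- Lower bound.  MOO and OPT both occupy nodes u and w of layer D − 1.  Request a
-- common child of u and w in layer D; by locality MOO takes its server from u
-- or w, and OPT from the other one.  Request the node MOO left, where OPT still
-- has a server, and a fresh node of layer D − 1 adjacent to the child, to which
-- OPT moves the server at the child.  MOO has paid 1 + 2 (D − 1), OPT only 2,
-- and the two nodes requested last take the roles of u and w.
module Submission where

open import Defs
open import Data.Bool using (true; false; T; if_then_else_)
open import Data.Fin as Fin using (Fin; inject₁; toℕ)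
open import Data.Fin.Properties using (toℕ-fromℕ; toℕ-inject₁; toℕ-injective; toℕ≤pred[n])
open import Data.List using (List; []; _∷_; filter; map)
open import Data.List.Membership.Propositional using (_∈_)
open import Data.List.Membership.Propositional.Properties using (∈-filter⁻)
open import Data.List.Properties using (filter-accept; filter-all; filter-reject)
open import Data.List.Relation.Unary.All as All using (All; []; _∷_)
open import Data.List.Relation.Unary.AllPairs using ([]; _∷_)
open import Data.List.Relation.Unary.Any using (here; there)
open import Data.List.Relation.Unary.Unique.Propositional using (Unique)
open import Data.List.Relation.Unary.Unique.Propositional.Properties using (filter⁺)
open import Data.Nat as ℕ using (ℕ; _≤_)
open import Data.Nat.ListAction using (sum)
open import Data.Product using (Σ-syntax; ∃-syntax; _×_; _,_; proj₁; proj₂)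
open import Data.Rational as ℚ using (ℚ; ½; 0ℚ; _/_; _-_; _<_)
import Data.Rational.Properties as ℚ
open import Data.Sum as Sum using (_⊎_; inj₁; inj₂; [_,_]′)
open import Data.Unit using (tt)
open import Function using (_∘_; case_of_)
open import Level using (0ℓ)
open import Relation.Binary using (Rel; Symmetric; DecidableEquality)
open import Relation.Binary.Construct.Closure.ReflexiveTransitive using (Star; ε; _◅_)
open import Relation.Binary.PropositionalEquality
open import Relation.Nullary using (¬_; Dec; does; yes; no; contradiction; ¬?)
open import Relation.Nullary.Decidable using (map′; _×-dec_; dec-true)

-- Rational arithmetic and the Archimedean property.

module Rationals where
  open import Data.Integer as ℤ using (+_)
  import Data.Integer.Properties as ℤ
  import Data.Nat.Coprimality as Coprime
  open import Data.Nat using (suc; z≤n; s≤s)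
  open import Data.Rational hiding (_≤_)
  open import Data.Rational.Properties
  open import Data.Rational.Solver using (module +-*-Solver)
  open +-*-Solver

  ι : ℕ → ℚ
  ι n = + n / 1

  ι≡mkℚ : ∀ n → ι n ≡ mkℚ (+ n) 0 (Coprime.sym (Coprime.1-coprimeTo n))
  ι≡mkℚ n = ↥p/↧p≡p (mkℚ (+ n) 0 (Coprime.sym (Coprime.1-coprimeTo n)))

  ι-+ : ∀ m n → ι (m ℕ.+ n) ≡ ι m + ι n
  ι-+ m n rewrite ι≡mkℚ m | ι≡mkℚ n =
    cong (_/ 1) (sym (cong₂ ℤ._+_ (ℤ.*-identityʳ (+ m)) (ℤ.*-identityʳ (+ n))))

  ι-* : ∀ m n → ι (m ℕ.* n) ≡ ι m * ι n
  ι-* m n rewrite ι≡mkℚ m | ι≡mkℚ n = cong (_/ 1) (ℤ.pos-* m n)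

  ι-mono-≤ : ∀ {m n} → m ≤ n → ι m ℚ.≤ ι n
  ι-mono-≤ {m} {n} m≤n rewrite ι≡mkℚ m | ι≡mkℚ n =
    *≤* (ℤ.*-monoʳ-≤-nonNeg (+ 1) (ℤ.+≤+ m≤n))

  below-ι : ∀ p → ∃[ n ] p ℚ.≤ ι n
  below-ι p@(mkℚ (+ n) _ _) = n , subst (p ℚ.≤_) (sym (ι≡mkℚ n))
    (*≤* (ℤ.*-monoˡ-≤-nonNeg (+ n) (ℤ.+≤+ (s≤s z≤n))))
  below-ι (mkℚ ℤ.-[1+ _ ] _ _) = 0 , *≤* ℤ.-≤+

  -- Take `n` above `K / δ`; its successor makes the inequality strict.
  archimedean : ∀ {δ} → 0ℚ < δ → ∀ K → ∃[ n ] K < δ * ι n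
  archimedean {δ} 0<δ K = suc n , (begin-strict
    K               ≡⟨ *-identityˡ K ⟨
    1ℚ * K          ≡⟨ cong (_* K) (*-inverseʳ δ) ⟨
    δ * 1/ δ * K    ≡⟨ *-assoc δ (1/ δ) K ⟩
    δ * (1/ δ * K)  ≤⟨ *-monoˡ-≤-nonNeg δ ⦃ pos⇒nonNeg δ ⦄ (proj₂ (below-ι (1/ δ * K))) ⟩
    δ * ι n         ≡⟨ +-identityʳ _ ⟨
    δ * ι n + 0ℚ    <⟨ +-monoʳ-< (δ * ι n) 0<δ ⟩
    δ * ι n + δ     ≡⟨ solve 2 (λ d m → d :* m :+ d := d :* (con 1ℚ :+ m)) refl δ (ι n) ⟩
    δ * (1ℚ + ι n)  ≡⟨ cong (δ *_) (ι-+ 1 n) ⟨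
    δ * ι (suc n)   ∎)
    where
    open ≤-Reasoning
    instance
      δ-pos : Positive δ
      δ-pos = positive 0<δ
      δ-nonZero : NonZero δ
      δ-nonZero = pos⇒nonZero δ
    n : ℕ
    n = proj₁ (below-ι (1/ δ * K))

  -- The combinatorial bounds stay in ℕ and compare `2 * a + q` with `2 * d * q`. The monotone map
  -- from `z` to `½ * z - ½ * ι q` turns these into `a` and `(d - ½) * q`; this lemma and the next
  -- compute its two values.
  half-2a+q : ∀ a q → ½ * ι (2 ℕ.* a ℕ.+ q) - ½ * ι q ≡ ι a
  half-2a+q a q = begin
    ½ * ι (2 ℕ.* a ℕ.+ q) - ½ * ι q
      ≡⟨ cong (λ z → ½ * z - ½ * ι q) (trans (ι-+ (2 ℕ.* a) q) (cong (_+ ι q) (ι-* 2 a))) ⟩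
    ½ * (ι 2 * ι a + ι q) - ½ * ι q
      ≡⟨ solve 2 (λ A Q → con ½ :* (con (ι 2) :* A :+ Q) :+ :- (con ½ :* Q) := A) refl (ι a) (ι q) ⟩
    ι a ∎
    where open ≡-Reasoning

  half-2dq : ∀ d q → ½ * ι (2 ℕ.* d ℕ.* q) - ½ * ι q ≡ (ι d - ½) * ι q
  half-2dq d q = begin
    ½ * ι (2 ℕ.* d ℕ.* q) - ½ * ι q
      ≡⟨ cong (λ z → ½ * z - ½ * ι q) (trans (ι-* (2 ℕ.* d) q) (cong (_* ι q) (ι-* 2 d))) ⟩
    ½ * (ι 2 * ι d * ι q) - ½ * ι q
      ≡⟨ solve 2 (λ D Q → con ½ :* (con (ι 2) :* D :* Q) :+ :- (con ½ :* Q) := (D :+ :- con ½) :* Q)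
           refl (ι d) (ι q) ⟩
    (ι d - ½) * ι q ∎
    where open ≡-Reasoning

  halve-mono-≤ : ∀ {m n} q → m ≤ n → ½ * ι m - ½ * ι q ℚ.≤ ½ * ι n - ½ * ι q
  halve-mono-≤ q m≤n = +-monoˡ-≤ (- (½ * ι q)) (*-monoˡ-≤-nonNeg ½ (ι-mono-≤ m≤n))

  2a+q≤2dq⇒a≤[d-½]q : ∀ d a q → 2 ℕ.* a ℕ.+ q ≤ 2 ℕ.* d ℕ.* q → ι a ℚ.≤ (ι d - ½) * ι q
  2a+q≤2dq⇒a≤[d-½]q d a q = subst₂ ℚ._≤_ (half-2a+q a q) (half-2dq d q) ∘ halve-mono-≤ q

  2dq≤2a+q⇒[d-½]q≤a : ∀ d a q → 2 ℕ.* d ℕ.* q ≤ 2 ℕ.* a ℕ.+ q → (ι d - ½) * ι q ℚ.≤ ι a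
  2dq≤2a+q⇒[d-½]q≤a d a q = subst₂ ℚ._≤_ (half-2dq d q) (half-2a+q a q) ∘ halve-mono-≤ q

  -- Together the two inequalities give `(w - ρ) * q ≤ b + c`, which fails for large `q`. The
  -- threshold is on `q` because the optimum will be known only through bounds.
  eventually-exceeds : ∀ {w ρ} → ρ < w → ∀ b c → ∃[ t ] ∀ {a q} → t ≤ q →
    w * ι q ℚ.≤ ι a + b → ¬ ι a ℚ.≤ ρ * ι q + c
  eventually-exceeds {w} {ρ} ρ<w b c = t , λ {a} {q} t≤q below above → <-irrefl refl (begin-strict
    b + c                              <⟨ proj₂ far ⟩
    (w - ρ) * ι t                      ≤⟨ *-monoˡ-≤-nonNeg (w - ρ) ⦃ δ-nonNeg ⦄ (ι-mono-≤ t≤q) ⟩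
    (w - ρ) * ι q                      ≡⟨ solve 3 (λ W R Q → (W :+ :- R) :* Q := W :* Q :+ :- (R :* Q))
                                            refl w ρ (ι q) ⟩
    w * ι q - ρ * ι q                  ≤⟨ +-monoˡ-≤ (- (ρ * ι q)) below ⟩
    ι a + b - ρ * ι q                  ≤⟨ +-monoˡ-≤ (- (ρ * ι q)) (+-monoˡ-≤ b above) ⟩
    ρ * ι q + c + b - ρ * ι q          ≡⟨ solve 3 (λ X B C → X :+ C :+ B :+ :- X := B :+ C)
                                            refl (ρ * ι q) b c ⟩
    b + c                              ∎)
    where
    open ≤-Reasoning
    0<δ : 0ℚ < w - ρ
    0<δ = subst (_< w - ρ) (+-inverseʳ ρ) (+-monoˡ-< (- ρ) ρ<w)
    δ-nonNeg : NonNegative (w - ρ)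
    δ-nonNeg = pos⇒nonNeg (w - ρ) ⦃ positive 0<δ ⦄
    far : ∃[ n ] b + c < (w - ρ) * ι n
    far = archimedean 0<δ (b + c)
    t : ℕ
    t = proj₁ far

open Rationals using (ι; ι-+; ι-mono-≤; 2a+q≤2dq⇒a≤[d-½]q; 2dq≤2a+q⇒[d-½]q≤a; eventually-exceeds)
open import Data.Nat hiding (_<_; _/_)
open import Data.Nat.Properties
open import Data.List.Membership.DecPropositional _≟_ using (_∈?_)
open import Data.Nat.Induction using (<-rec)
open import Data.Nat.Tactic.RingSolver using (solve-∀)

-- Finite sums over initial segments of ℕ.

∑< : ℕ → (ℕ → ℕ) → ℕ
∑< zero    f = 0
∑< (suc n) f = f n + ∑< n f

∑<-cong : ∀ n {f g} → (∀ i → f i ≡ g i) → ∑< n f ≡ ∑< n g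
∑<-cong zero    eq = refl
∑<-cong (suc n) eq = cong₂ _+_ (eq n) (∑<-cong n eq)

∑<-zero : ∀ n {f} → (∀ i → f i ≡ 0) → ∑< n f ≡ 0
∑<-zero zero    eq = refl
∑<-zero (suc n) eq = cong₂ _+_ (eq n) (∑<-zero n eq)

∑<-monoˡ-≤ : ∀ {m n} f → m ≤ n → ∑< m f ≤ ∑< n f
∑<-monoˡ-≤ f m≤n = go (≤⇒≤′ m≤n)
  where
  go : ∀ {m n} → m ≤′ n → ∑< m f ≤ ∑< n f
  go ≤′-refl       = ≤-refl
  go (≤′-step m≤n) = ≤-trans (go m≤n) (m≤n+m _ _)

-- Only the terms at `i` differ, and adding the other one on each side avoids subtraction.
∑<-update : ∀ {n i f g} → i ℕ.< n → (∀ j → i ≢ j → f j ≡ g j) →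
            ∑< n f + g i ≡ ∑< n g + f i
∑<-update {suc n} {i} {f} {g} i<1+n eq with i ≟ n
... | yes refl = trans (cong (λ s → f n + s + g n) (below n ≤-refl))
                       (swap (f n) (∑< n g) (g n))
  where
  swap : ∀ a s b → a + s + b ≡ b + s + a
  swap = solve-∀
  below : ∀ m → m ≤ n → ∑< m f ≡ ∑< m g
  below zero    _   = refl
  below (suc m) m<n = cong₂ _+_ (eq m (>⇒≢ m<n)) (below m (<⇒≤ m<n))
... | no i≢n = begin
  f n + ∑< n f + g i    ≡⟨ +-assoc (f n) _ _ ⟩
  f n + (∑< n f + g i)  ≡⟨ cong₂ _+_ (eq n i≢n) (∑<-update (≤∧≢⇒< (s≤s⁻¹ i<1+n) i≢n) eq) ⟩
  g n + (∑< n g + f i)  ≡⟨ +-assoc (g n) _ _ ⟨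
  g n + ∑< n g + f i    ∎
  where open ≡-Reasoning

-- Walks and the shortest-path metric.

module _ {V : Set} {E : Rel V 0ℓ} where

  snoc : ∀ {u v w n} → Walk E u v n → E v w → Walk E u w (suc n)
  snoc stop       e = step e stop
  snoc (step f p) e = step f (snoc p e)

  reverse : Symmetric E → ∀ {u v n} → Walk E u v n → Walk E v u n
  reverse E-sym stop       = stop
  reverse E-sym (step e p) = snoc (reverse E-sym p) (E-sym e)

module Metric {D : ℕ} (G : LayeredGraph D) where
  open LayeredGraph G

  dist-refl : ∀ u → dist u u ≡ 0
  dist-refl u = n≤0⇒n≡0 (dist-minimal stop)

  dist≡0⇒≡ : ∀ {u v} → dist u v ≡ 0 → u ≡ v
  dist≡0⇒≡ {u} {v} eq with stop ← subst (Walk Adj u v) eq (dist-walk u v) = refl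

  dist≡1⇒Adj : ∀ {u v} → dist u v ≡ 1 → Adj u v
  dist≡1⇒Adj {u} {v} eq with step e stop ← subst (Walk Adj u v) eq (dist-walk u v) = e

  _≟ᴺ_ : DecidableEquality Node
  u ≟ᴺ v = map′ dist≡0⇒≡ (λ { refl → dist-refl u }) (dist u v ≟ 0)

  outward-walk : ∀ {u v} → Star AwayEdge u v → ∃[ n ] Walk Adj u v n × layer u + n ≡ layer v
  outward-walk ε = 0 , stop , +-identityʳ _
  outward-walk ((e , eq) ◅ es) with n , p , eq′ ← outward-walk es =
    suc n , step e p , trans (+-suc _ n) (trans (cong (_+ n) (sym eq)) eq′)

  -- Every outward edge raises the layer by one, so an outward path has as many edges as it gains
  -- layers. This bounds what MOO pays for a move.
  layer+dist≤layer : ∀ {u v} → Star AwayEdge u v → layer u + dist u v ≤ layer v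
  layer+dist≤layer path with n , p , eq ← outward-walk path =
    ≤-trans (+-monoʳ-≤ _ (dist-minimal p)) (≤-reflexive eq)

-- Configurations and the single steps of MOO.

module Servers {D : ℕ} (G : LayeredGraph D) where
  open LayeredGraph G
  open InfiniteServer G hiding (OnlineAlgorithm; IsMOO; Competitive)
  open Metric G

  move-moved : ∀ C i v → move C (i , v) i ≡ v
  move-moved C i v with i ≡ᵇ i in eq
  ... | true  = refl
  ... | false = contradiction (≡⇒≡ᵇ i i refl) (subst (¬_ ∘ T) (sym eq) λ ())

  move-other : ∀ C i {j} v → i ≢ j → move C (i , v) j ≡ C j
  move-other C i {j} v i≢j with i ≡ᵇ j in eq
  ... | true  = contradiction (≡ᵇ⇒≡ i j (subst T (sym eq) tt)) i≢j
  ... | false = refl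

  Occupied-moved : ∀ C i v → Occupied (move C (i , v)) v
  Occupied-moved C i v = i , move-moved C i v

  Occupied-move⁺ : ∀ {C v u} i → Occupied C u → C i ≢ u → Occupied (move C (i , v)) u
  Occupied-move⁺ {C} {v} i (j , eq) Ci≢u =
    j , trans (move-other C i v λ { refl → Ci≢u eq }) eq

  Occupied-move⁻ : ∀ {C v u} i → Occupied (move C (i , v)) u → Occupied C u ⊎ u ≡ v
  Occupied-move⁻ {C} {v} i (j , eq) with i ≟ j
  ... | yes refl = inj₂ (trans (sym eq) (move-moved C i v))
  ... | no  i≢j  = inj₁ (j , trans (sym (move-other C i v i≢j)) eq)

  module _ (A : OnlineAlgorithm G) where
    open OnlineAlgorithm A

    -- Laziness leaves these two kinds of answer. Equations for the configuration and the cost spare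
    -- later case distinctions from inspecting `respond`.
    data Step (σ : Requests) (r : Node) : Set where
      stay : config (r ∷ σ) ≡ config σ → ALG (r ∷ σ) ≡ ALG σ → Step σ r
      send : ∀ i → ¬ Occupied (config σ) r →
             config (r ∷ σ) ≡ move (config σ) (i , r) →
             ALG (r ∷ σ) ≡ ALG σ + dist (config σ i) r →
             LocalMove A (config σ) (i , r) → OutwardMove A (config σ) (i , r) →
             Step σ r

  module MOO (A : OnlineAlgorithm G) (isMOO : IsMOO G A) where
    open OnlineAlgorithm A
    open IsMOO isMOO

    take-step : ∀ σ r → Step A σ r
    take-step σ r with respond σ r in eq
    ... | [] = stay (cong (moves (config σ)) eq)
                    (trans (cong (λ ms → ALG σ + cost (config σ) ms) eq) (+-identityʳ _))
    -- By laziness an occupied request would have received the empty answer.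
    ... | m ∷ ms with unoccupied ← (λ occ → case trans (sym eq) (proj₁ (lazy σ r) occ) of λ ())
                 with i , sent ← proj₂ (lazy σ r) unoccupied =
      send i unoccupied (cong (moves (config σ)) sent)
        (trans (cong (λ ms → ALG σ + cost (config σ) ms) sent) (cong (ALG σ +_) (+-identityʳ _)))
        (proj₁ (subst (EachMove (LocalMove A) (config σ)) sent (local σ r)))
        (proj₁ (subst (EachMove (OutwardMove A) (config σ)) sent (outward σ r)))

    Occupied-step : ∀ {σ r u} → Occupied (config (r ∷ σ)) u → Occupied (config σ) u ⊎ u ≡ r
    Occupied-step {σ} {r} occ with take-step σ r
    ... | stay eq _         = inj₁ (subst (λ C → Occupied C _) eq occ)
    ... | send i _ eq _ _ _ = Occupied-move⁻ i (subst (λ C → Occupied C _) eq occ)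

    -- A lazy algorithm sends servers only to unoccupied nodes, so no two of them meet away from
    -- their common start. Hence a node other than the source is empty once a server is taken from
    -- it.
    distinct : ∀ σ i j → config σ i ≡ config σ j → config σ i ≢ source → i ≡ j
    distinct []      i j _  i≢s = contradiction refl i≢s
    distinct (r ∷ σ) i j eq i≢s with take-step σ r
    ... | stay same _ rewrite same = distinct σ i j eq i≢s
    ... | send m unocc same _ _ _ rewrite same with m ≟ i | m ≟ j
    ...   | yes refl | yes refl = refl
    ...   | yes refl | no  m≢j  = contradiction
      (j , trans (sym (move-other (config σ) m r m≢j)) (trans (sym eq) (move-moved (config σ) m r))) unocc
    ...   | no  m≢i  | yes refl = contradiction
      (i , trans (sym (move-other (config σ) m r m≢i)) (trans eq (move-moved (config σ) m r))) unocc
    ...   | no  m≢i  | no  m≢j  = distinct σ i j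
      (trans (sym (move-other (config σ) m r m≢i)) (trans eq (move-other (config σ) m r m≢j)))
      (i≢s ∘ trans (move-other (config σ) m r m≢i))

-- Upper bound by charging nodes and servers.

module UpperBound {D : ℕ} (2≤D : 2 ≤ D) (G : LayeredGraph D) where
  open LayeredGraph G
  open InfiniteServer G hiding (OnlineAlgorithm; IsMOO; Competitive)
  open Metric G
  open Servers G

  layers : List Node → ℕ
  layers L = sum (map layer L)

  differs? : ∀ b u → Dec (u ≢ b)
  differs? b u = ¬? (u ≟ᴺ b)

  without : Node → List Node → List Node
  without b = filter (differs? b)

  ∈-without⁻ : ∀ {b u} L → u ∈ without b L → u ∈ L × u ≢ b
  ∈-without⁻ {b} L = ∈-filter⁻ (differs? b) {xs = L}

  -- Uniqueness lets `b` occur at most once; the inequality also covers lists without `b`.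
  layers-without : ∀ b {L} → Unique L → layers L ≤ layer b + layers (without b L)
  layers-without b {[]}    []        = z≤n
  layers-without b {u ∷ L} (u∉L ∷ !L) with u ≟ᴺ b
  ... | yes refl = +-monoʳ-≤ (layer u) (≤-reflexive (cong layers (sym removed)))
    where
    removed : without u (u ∷ L) ≡ L
    removed = trans (filter-reject (differs? u) (λ u≢u → u≢u refl))
                    (filter-all (differs? u) (All.map (_∘ sym) u∉L))
  ... | no u≢b = begin
    layer u + layers L                          ≤⟨ +-monoʳ-≤ (layer u) (layers-without b !L) ⟩
    layer u + (layer b + layers (without b L))  ≡⟨ swap (layer u) (layer b) _ ⟩
    layer b + layers (u ∷ without b L)          ≡⟨ cong (λ M → layer b + layers M) kept ⟨
    layer b + layers (without b (u ∷ L))        ∎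
    where
    open ≤-Reasoning
    kept : without b (u ∷ L) ≡ u ∷ without b L
    kept = filter-accept (differs? b) u≢b
    swap : ∀ a b c → a + (b + c) ≡ b + (a + c)
    swap = solve-∀

  -- The indicator of the layers strictly between 0 and D.
  inner : Node → ℕ
  inner v = (1 ⊓ layer v) ⊓ (D ∸ layer v)

  inner≤1 : ∀ v → inner v ≤ 1
  inner≤1 v = ≤-trans (m⊓n≤m _ _) (m⊓n≤m 1 _)

  inner-last : ∀ {v} → layer v ≡ D → inner v ≡ 0
  inner-last {v} eq = n≤0⇒n≡0 (≤-trans (m⊓n≤n _ (D ∸ layer v))
                                       (≤-reflexive (m≤n⇒m∸n≡0 (≤-reflexive (sym eq)))))

  inner-penultimate : ∀ {v} → D ≡ suc (layer v) → 1 ≤ inner v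
  inner-penultimate {v} D≡ =
    ⊓-glb (⊓-glb ≤-refl (s≤s⁻¹ (≤-trans 2≤D (≤-reflexive D≡))))
              (m<n⇒0<n∸m (≤-reflexive (sym D≡)))
  double-layer-bound : ∀ {v} → layer v ℕ.< D → 2 * layer v + inner v + 1 ≤ 2 * D
  double-layer-bound {v} v<D = begin
    2 * layer v + inner v + 1  ≤⟨ +-monoˡ-≤ 1 (+-monoʳ-≤ (2 * layer v) (inner≤1 v)) ⟩
    2 * layer v + 1 + 1        ≡⟨ double-suc (layer v) ⟩
    2 * suc (layer v)          ≤⟨ *-monoʳ-≤ 2 v<D ⟩
    2 * D                      ∎
    where
    open ≤-Reasoning
    double-suc : ∀ n → 2 * n + 1 + 1 ≡ 2 * suc n
    double-suc = solve-∀

  -- The delicate case is an edge into layer `D`: there `inner b` is 0, and `a` lies in layer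
  -- `D - 1`, which is inner because `2 ≤ D`, so `inner a` pays the extra unit. An edge ending below
  -- layer `D` has two units to spare from the missing layer. For a length `d` of at least 2, the
  -- node takes at most `2 * D`, and the remaining `2 * D * (d - 1)` covers `d`.
  move-bound : ∀ {a b} → a ≢ b →
    2 * layer b + inner b + dist a b ≤ inner a + 2 * D * dist a b
  move-bound {a} {b} a≢b with dist a b in eq
  ... | 0 = contradiction (dist≡0⇒≡ eq) a≢b
  ... | 1 with m≤n⇒m<n∨m≡n (layer≤D b)
  ...   | inj₁ b<D = ≤-trans (double-layer-bound b<D)
                       (≤-trans (≤-reflexive (sym (*-identityʳ _))) (m≤n+m _ _))
  ...   | inj₂ b≡D with Adj-layers (dist≡1⇒Adj eq)
  ...     | inj₂ a≡1+b = contradiction (subst (_≤ D) (trans a≡1+b (cong suc b≡D)) (layer≤D a)) 1+n≰n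
  ...     | inj₁ b≡1+a = begin
    2 * layer b + inner b + 1  ≡⟨ cong₂ (λ l i → 2 * l + i + 1) b≡D (inner-last b≡D) ⟩
    2 * D + 0 + 1              ≡⟨ shuffle D ⟩
    1 + 2 * D * 1              ≤⟨ +-monoˡ-≤ _ (inner-penultimate (trans (sym b≡D) b≡1+a)) ⟩
    inner a + 2 * D * 1        ∎
    where
    open ≤-Reasoning
    shuffle : ∀ d → 2 * d + 0 + 1 ≡ 1 + 2 * d * 1
    shuffle = solve-∀
  move-bound {a} {b} a≢b | suc (suc n) = begin
    2 * layer b + inner b + suc (suc n)  ≤⟨ +-mono-≤ both rest ⟩
    2 * D + 2 * D * suc n                ≡⟨ *-suc (2 * D) (suc n) ⟨
    2 * D * suc (suc n)                  ≤⟨ m≤n+m _ _ ⟩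
    inner a + 2 * D * suc (suc n)        ∎
    where
    open ≤-Reasoning
    both : 2 * layer b + inner b ≤ 2 * D
    both with m≤n⇒m<n∨m≡n (layer≤D b)
    ... | inj₁ b<D = ≤-trans (m≤m+n _ 1) (double-layer-bound b<D)
    ... | inj₂ b≡D = ≤-reflexive (trans (cong₂ (λ l i → 2 * l + i) b≡D (inner-last b≡D)) (+-identityʳ _))
    rest : suc (suc n) ≤ 2 * D * suc n
    rest = begin
      suc (suc n)    ≤⟨ s≤s (m≤n+m (suc n) n) ⟩
      suc n + suc n  ≡⟨ cong (suc n +_) (+-identityʳ _) ⟨
      2 * suc n      ≤⟨ *-monoˡ-≤ (suc n) (≤-trans 2≤D (m≤n*m D 2)) ⟩
      2 * D * suc n  ∎

  -- Infinitely many servers are handled by bounding every finite part of the charge: the first `n`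
  -- servers of OPT and any duplicate-free list of nodes occupied by MOO or OPT. The summand `q` on
  -- the left stands for a factor `2 * D - 1` on the right.
  Charged : Config → Config → ℕ → Set
  Charged M C q = ∀ n L → Unique L → (∀ {u} → u ∈ L → Occupied M u ⊎ Occupied C u) →
    2 * layers L + ∑< n (inner ∘ C) + q ≤ 2 * D * q

  Charged-initial : Charged initial initial 0
  Charged-initial n L !L L⊆ = ≤-reflexive
    (trans (cong₂ (λ a b → 2 * a + b + 0) (layers≡0 L λ u∈L → [ at-source , at-source ]′ (L⊆ u∈L))
                                          (∑<-zero n λ _ → inner-source))
           (sym (*-zeroʳ (2 * D))))
    where
    inner-source : inner source ≡ 0
    inner-source rewrite layer-source = refl
    at-source : ∀ {u} → Occupied initial u → layer u ≡ 0
    at-source (_ , refl) = layer-source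
    layers≡0 : ∀ L → (∀ {u} → u ∈ L → layer u ≡ 0) → layers L ≡ 0
    layers≡0 []      _  = refl
    layers≡0 (u ∷ L) eq = cong₂ _+_ (eq (here refl)) (layers≡0 L (eq ∘ there))

  Charged-move : ∀ {M C q} i b → Charged M C q → Charged M (move C (i , b)) (q + dist (C i) b)
  Charged-move {M} {C} {q} i b charged n L !L L⊆ with C i ≟ᴺ b
  -- `move-bound` does not cover a server sent to its own node; such a move is free and leaves the
  -- configuration pointwise unchanged.
  ... | yes refl = begin
    2 * layers L + ∑< n (inner ∘ C′) + (q + dist b b)
      ≡⟨ cong₂ (λ s d → 2 * layers L + s + d) (∑<-cong n (cong inner ∘ same)) q+0 ⟩
    2 * layers L + ∑< n (inner ∘ C) + q
      ≤⟨ charged n L !L (Sum.map₂ (λ { (j , eq) → j , trans (sym (same j)) eq }) ∘ L⊆) ⟩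
    2 * D * q
      ≡⟨ cong (2 * D *_) q+0 ⟨
    2 * D * (q + dist b b) ∎
    where
    open ≤-Reasoning
    C′ = move C (i , b)
    same : ∀ j → C′ j ≡ C j
    same j with i ≟ j
    ... | yes refl = move-moved C i b
    ... | no  i≢j  = move-other C i b i≢j
    q+0 : q + dist b b ≡ q
    q+0 = trans (cong (q +_) (dist-refl b)) (+-identityʳ q)
  -- The added `inner a` is the charge that the server loses by leaving `a`.
  ... | no a≢b = +-cancelˡ-≤ (inner a) _ _ (begin
    inner a + (2 * layers L + ∑< n (inner ∘ C′) + (q + dist a b))
      ≤⟨ +-monoʳ-≤ (inner a) (+-monoˡ-≤ _ (+-mono-≤ (*-monoʳ-≤ 2 (layers-without b !L))
                                                  (∑<-monoˡ-≤ _ (m≤m⊔n n (suc i))))) ⟩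
    inner a + (2 * (layer b + layers L₀) + ∑< N (inner ∘ C′) + (q + dist a b))
      ≡⟨ shuffle₁ (inner a) (layer b) (layers L₀) (∑< N (inner ∘ C′)) q (dist a b) ⟩
    2 * layer b + 2 * layers L₀ + (∑< N (inner ∘ C′) + inner a) + q + dist a b
      ≡⟨ cong (λ s → 2 * layer b + 2 * layers L₀ + s + q + dist a b) exchange ⟩
    2 * layer b + 2 * layers L₀ + (∑< N (inner ∘ C) + inner b) + q + dist a b
      ≡⟨ shuffle₂ (layer b) (layers L₀) (∑< N (inner ∘ C)) (inner b) q (dist a b) ⟩
    (2 * layer b + inner b + dist a b) + (2 * layers L₀ + ∑< N (inner ∘ C) + q)
      ≤⟨ +-mono-≤ (move-bound a≢b) (charged N L₀ (filter⁺ (differs? _) !L) L₀⊆) ⟩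
    (inner a + 2 * D * dist a b) + 2 * D * q
      ≡⟨ shuffle₃ (inner a) (2 * D) (dist a b) q ⟩
    inner a + 2 * D * (q + dist a b) ∎)
    where
    open ≤-Reasoning
    a  = C i
    C′ = move C (i , b)
    -- The range grows to include server `i`, so that `inner a` is among the terms of the old sum.
    N  = n ⊔ suc i
    -- The node `b` may be newly occupied, so it is taken out before the bound for the old
    -- configuration is applied.
    L₀ = without b L
    exchange : ∑< N (inner ∘ C′) + inner a ≡ ∑< N (inner ∘ C) + inner b
    exchange = trans (∑<-update (m≤n⊔m n (suc i)) λ j i≢j → cong inner (move-other C i b i≢j))
                     (cong (λ v → ∑< N (inner ∘ C) + inner v) (move-moved C i b))
    L₀⊆ : ∀ {u} → u ∈ L₀ → Occupied M u ⊎ Occupied C u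
    L₀⊆ u∈L₀ with u∈L , u≢b ← ∈-without⁻ L u∈L₀ with L⊆ u∈L
    ... | inj₁ occ = inj₁ occ
    ... | inj₂ occ with Occupied-move⁻ i occ
    ...   | inj₁ occ′ = inj₂ occ′
    ...   | inj₂ u≡b  = contradiction u≡b u≢b
    shuffle₁ : ∀ g l s t q d → g + (2 * (l + s) + t + (q + d)) ≡ 2 * l + 2 * s + (t + g) + q + d
    shuffle₁ = solve-∀
    shuffle₂ : ∀ l s t g q d → 2 * l + 2 * s + (t + g) + q + d ≡ (2 * l + g + d) + (2 * s + t + q)
    shuffle₂ = solve-∀
    shuffle₃ : ∀ g k d q → (g + k * d) + k * q ≡ g + k * (q + d)
    shuffle₃ = solve-∀

  Charged-moves : ∀ {M C q} ms → Charged M C q → Charged M (moves C ms) (q + cost C ms)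
  Charged-moves {q = q} [] charged = subst (Charged _ _) (sym (+-identityʳ q)) charged
  Charged-moves {q = q} ((i , b) ∷ ms) charged =
    subst (Charged _ _) (+-assoc q _ _) (Charged-moves ms (Charged-move i b charged))

  module _ (A : OnlineAlgorithm G) (isMOO : IsMOO G A) where
    open OnlineAlgorithm A
    open MOO A isMOO

    -- MOO gains at most the requested node, and OPT occupies that node after serving it. So every
    -- node to be counted is an old node of MOO or a new one of OPT, and only the moves of OPT are
    -- charged.
    Charged-schedule : ∀ {σ C q} → Schedule σ C q → Charged (config σ) C q
    Charged-schedule start = Charged-initial
    Charged-schedule (serve s ms occ) n L !L L⊆ =
      Charged-moves ms (Charged-schedule s) n L !L λ u∈L → case L⊆ u∈L of λ where
        (inj₂ occ′) → inj₂ occ′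
        (inj₁ occ′) → case Occupied-step occ′ of λ where
          (inj₁ occ″) → inj₁ occ″
          (inj₂ refl) → inj₂ occ

    -- Going outward from `a` to `r` costs at most the gain in layer, and replacing `a` by `r` in
    -- the list makes up for it; `r` is new because it was unoccupied.
    ALG≤layers : ∀ σ → Σ[ L ∈ List Node ] Unique L × (∀ {u} → u ∈ L → Occupied (config σ) u) ×
                       ALG σ ≤ layers L
    ALG≤layers [] = [] , [] , (λ ()) , z≤n
    ALG≤layers (r ∷ σ) with L , !L , L⊆ , ALG≤ ← ALG≤layers σ with take-step σ r
    ... | stay eq alg = L , !L , (λ u∈L → subst (λ C → Occupied C _) (sym eq) (L⊆ u∈L)) ,
                        ≤-trans (≤-reflexive alg) ALG≤
    ... | send i unocc eq alg _ out = r ∷ L₀ , r∉L₀ ∷ filter⁺ (differs? _) !L , occ , bound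
      where
      a  = config σ i
      L₀ = without a L
      r∉L₀ : All (r ≢_) L₀
      r∉L₀ = All.tabulate λ u∈L₀ r≡u →
        unocc (subst (Occupied _) (sym r≡u) (L⊆ (proj₁ (∈-without⁻ L u∈L₀))))
      occ : ∀ {u} → u ∈ r ∷ L₀ → Occupied (config (r ∷ σ)) u
      occ u∈ rewrite eq with u∈
      ... | here refl  = Occupied-moved _ i r
      ... | there u∈L₀ with u∈L , u≢a ← ∈-without⁻ L u∈L₀ = Occupied-move⁺ i (L⊆ u∈L) (u≢a ∘ sym)
      bound : ALG (r ∷ σ) ≤ layer r + layers L₀
      bound = begin
        ALG (r ∷ σ)                        ≡⟨ alg ⟩
        ALG σ + dist a r                   ≤⟨ +-monoˡ-≤ _ (≤-trans ALG≤ (layers-without a !L)) ⟩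
        layer a + layers L₀ + dist a r     ≡⟨ swap (layer a) (layers L₀) (dist a r) ⟩
        layer a + dist a r + layers L₀     ≤⟨ +-monoˡ-≤ _ (layer+dist≤layer out) ⟩
        layer r + layers L₀                ∎
        where
        open ≤-Reasoning
        swap : ∀ a b c → a + b + c ≡ a + c + b
        swap = solve-∀

    2ALG+cost≤2Dcost : ∀ {σ C q} → Schedule σ C q → 2 * ALG σ + q ≤ 2 * D * q
    2ALG+cost≤2Dcost {σ} {q = q} s with L , !L , L⊆ , ALG≤ ← ALG≤layers σ = begin
      2 * ALG σ + q         ≤⟨ +-monoˡ-≤ q (*-monoʳ-≤ 2 ALG≤) ⟩
      2 * layers L + q      ≡⟨ cong (_+ q) (+-identityʳ (2 * layers L)) ⟨
      -- With `n` equal to 0 only the layers of MOO's nodes remain.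
      2 * layers L + 0 + q  ≤⟨ Charged-schedule s 0 L !L (inj₁ ∘ L⊆) ⟩
      2 * D * q             ∎
      where open ≤-Reasoning

-- The graph for the lower bound and its distances.

module WideGraph (k : ℕ) where

  -- The leaf of a round has the index n of the round.  All leaves are adjacent
  -- to mid 0, which is never requested: this makes their mutual distances 2.
  data Node : Set where
    low  : Fin (suc k) → Node
    mid  : ℕ → Node
    leaf : ℕ → ℕ → Node

  layer : Node → ℕ
  layer (low i)    = toℕ i
  layer (mid _)    = suc k
  layer (leaf _ _) = suc (suc k)

  -- In round `n` OPT holds `mid x` and `mid n`, and `mid (suc n)` is the fresh node. The value of
  -- `x` depends on earlier answers of MOO while the graph is fixed beforehand, so every `x` has its
  -- own leaf.
  parents : ℕ → ℕ → List ℕ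
  parents x n = 0 ∷ x ∷ n ∷ suc n ∷ []

  data Parent : Rel Node 0ℓ where
    low-low  : ∀ i → Parent (low (inject₁ i)) (low (Fin.suc i))
    low-mid  : ∀ a → Parent (low (Fin.fromℕ k)) (mid a)
    mid-leaf : ∀ {a x n} → a ∈ parents x n → Parent (mid a) (leaf x n)

  Adj : Rel Node 0ℓ
  Adj u v = Parent u v ⊎ Parent v u

  layer-Parent : ∀ {u v} → Parent u v → layer v ≡ suc (layer u)
  layer-Parent (low-low i)  = cong suc (sym (toℕ-inject₁ i))
  layer-Parent (low-mid _)  = cong suc (sym (toℕ-fromℕ k))
  layer-Parent (mid-leaf _) = refl

  source : Node
  source = low Fin.zero

  parent-of : ∀ v → v ≢ source → ∃[ u ] Parent u v
  parent-of (low Fin.zero)    v≢s = contradiction refl v≢s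
  parent-of (low (Fin.suc i)) _   = _ , low-low i
  parent-of (mid a)           _   = _ , low-mid a
  parent-of (leaf x n)        _   = mid 0 , mid-leaf (here refl)

  -- The low nodes form a path with one node per layer, and everything else hangs from its last
  -- node; hence the layer differences. A mid and a leaf that are not adjacent are joined by three
  -- edges through `mid 0`.
  dist : Node → Node → ℕ
  dist (low i)    v          = ∣ toℕ i - layer v ∣
  dist u          (low j)    = ∣ layer u - toℕ j ∣
  dist (mid a)    (mid b)    = if does (a ≟ b) then 0 else 2
  dist (mid a)    (leaf x n) = if does (a ∈? parents x n) then 1 else 3
  dist (leaf x n) (mid a)    = if does (a ∈? parents x n) then 1 else 3
  dist (leaf x m) (leaf y n) = if does ((x ≟ y) ×-dec (m ≟ n)) then 0 else 2

  source-unique : ∀ v → layer v ≡ 0 → v ≡ source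
  source-unique (low i) eq = cong low (toℕ-injective eq)

  -- Passing from `v` to parents `n` times ends in the layer of `low i`, where `low i` is the only
  -- node.
  from-low : ∀ n i v → layer v ≡ n + toℕ i → Walk Adj (low i) v n
  from-low zero i (low j) eq with refl ← toℕ-injective eq = stop
  from-low zero i (mid a) eq = contradiction (≤-trans (≤-reflexive eq) (toℕ≤pred[n] i)) 1+n≰n
  from-low zero i (leaf x n) eq =
    contradiction (≤-trans (≤-reflexive eq) (toℕ≤pred[n] i)) (<⇒≱ (m<n⇒m<1+n (n<1+n k)))
  from-low (suc n) i v eq
    with u , u→v ← parent-of v (λ { refl → case eq of λ () }) =
    snoc (from-low n i u (suc-injective (trans (sym (layer-Parent u→v)) eq))) (inj₁ u→v)

  low-walk : ∀ i v → Walk Adj (low i) v ∣ toℕ i - layer v ∣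
  low-walk i v with ≤-total (toℕ i) (layer v)
  ... | inj₁ i≤v = from-low _ i v
    (trans (sym (m∸n+n≡m i≤v)) (cong (_+ toℕ i) (sym (m≤n⇒∣m-n∣≡n∸m i≤v))))
  low-walk i (low j) | inj₂ j≤i = reverse Sum.swap (from-low _ j (low i)
    (trans (sym (m∸n+n≡m j≤i)) (cong (_+ toℕ j) (sym (m≤n⇒∣n-m∣≡n∸m j≤i)))))
  low-walk i (mid a) | inj₂ v≤i = contradiction (≤-trans v≤i (toℕ≤pred[n] i)) 1+n≰n
  low-walk i (leaf x n) | inj₂ v≤i =
    contradiction (≤-trans v≤i (toℕ≤pred[n] i)) (<⇒≱ (m<n⇒m<1+n (n<1+n k)))

  to-low-walk : ∀ u j → Walk Adj u (low j) ∣ layer u - toℕ j ∣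
  to-low-walk u j = subst (Walk Adj u (low j)) (∣-∣-comm (toℕ j) (layer u)) (reverse Sum.swap (low-walk j u))

  mid-mid-walk : ∀ {a b} (a≟b : Dec (a ≡ b)) → Walk Adj (mid a) (mid b) (if does a≟b then 0 else 2)
  mid-mid-walk         (yes refl) = stop
  mid-mid-walk {a} {b} (no  _)    = step (inj₂ (low-mid a)) (step (inj₁ (low-mid b)) stop)

  mid-leaf-walk : ∀ {a x n} (a∈? : Dec (a ∈ parents x n)) →
                  Walk Adj (mid a) (leaf x n) (if does a∈? then 1 else 3)
  mid-leaf-walk     (yes a∈) = step (inj₁ (mid-leaf a∈)) stop
  mid-leaf-walk {a} (no  _)  =
    step (inj₂ (low-mid a)) (step (inj₁ (low-mid 0)) (step (inj₁ (mid-leaf (here refl))) stop))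

  leaf-leaf-walk : ∀ {x m y n} (≡? : Dec (x ≡ y × m ≡ n)) →
                   Walk Adj (leaf x m) (leaf y n) (if does ≡? then 0 else 2)
  leaf-leaf-walk (yes (refl , refl)) = stop
  leaf-leaf-walk (no  _) =
    step (inj₂ (mid-leaf (here refl))) (step (inj₁ (mid-leaf (here refl))) stop)

  dist-walk : ∀ u v → Walk Adj u v (dist u v)
  dist-walk (low i)    v          = low-walk i v
  dist-walk (mid a)    (low j)    = to-low-walk (mid a) j
  dist-walk (leaf x n) (low j)    = to-low-walk (leaf x n) j
  dist-walk (mid a)    (mid b)    = mid-mid-walk (a ≟ b)
  dist-walk (mid a)    (leaf x n) = mid-leaf-walk (a ∈? parents x n)
  dist-walk (leaf x n) (mid a)    = reverse Sum.swap (mid-leaf-walk (a ∈? parents x n))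
  dist-walk (leaf x m) (leaf y n) = leaf-leaf-walk ((x ≟ y) ×-dec (m ≟ n))

  ∣n-1+n∣≡1 : ∀ n → ∣ n - suc n ∣ ≡ 1
  ∣n-1+n∣≡1 zero    = refl
  ∣n-1+n∣≡1 (suc n) = ∣n-1+n∣≡1 n

  layer-Adj : ∀ {u v} → Adj u v → ∣ layer u - layer v ∣ ≡ 1
  layer-Adj {u} {v} (inj₁ p) rewrite layer-Parent p = ∣n-1+n∣≡1 (layer u)
  layer-Adj {u} {v} (inj₂ p) = trans (∣-∣-comm (layer u) (layer v)) (layer-Adj (inj₁ p))

  -- An edge changes the layer by one. This gives minimality for all distances with a low endpoint.
  layer-walk : ∀ {u v n} → Walk Adj u v n → ∣ layer u - layer v ∣ ≤ n
  layer-walk {u} stop = ≤-reflexive (∣n-n∣≡0 (layer u))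
  layer-walk {u} {v} (step {v = w} e p) =
    ≤-trans (∣-∣-triangle (layer u) (layer w) (layer v)) (+-mono-≤ (≤-reflexive (layer-Adj e)) (layer-walk p))

  mid-mid-minimal : ∀ {a b n} (a≟b : Dec (a ≡ b)) →
                    Walk Adj (mid a) (mid b) n → (if does a≟b then 0 else 2) ≤ n
  mid-mid-minimal (yes _)   _                      = z≤n
  mid-mid-minimal (no  a≢b) stop                   = contradiction refl a≢b
  mid-mid-minimal (no  _)   (step (inj₁ ()) stop)
  mid-mid-minimal (no  _)   (step (inj₂ ()) stop)
  mid-mid-minimal (no  _)   (step _ (step _ _))    = s≤s (s≤s z≤n)

  -- Layers alternate in parity along a walk, so its length is odd here; the absurd patterns are the
  -- walks of length 2.
  mid-leaf-minimal : ∀ {a x m n} (a∈? : Dec (a ∈ parents x m)) →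
                     Walk Adj (mid a) (leaf x m) n → (if does a∈? then 1 else 3) ≤ n
  mid-leaf-minimal (yes _)  (step _ _)                                     = s≤s z≤n
  mid-leaf-minimal (no  a∉) (step (inj₁ (mid-leaf a∈)) stop)               = contradiction a∈ a∉
  mid-leaf-minimal (no  _)  (step (inj₁ (mid-leaf _)) (step (inj₁ ()) stop))
  mid-leaf-minimal (no  _)  (step (inj₁ (mid-leaf _)) (step (inj₂ ()) stop))
  mid-leaf-minimal (no  _)  (step (inj₂ (low-mid _)) (step (inj₂ ()) stop))
  mid-leaf-minimal (no  _)  (step _ (step _ (step _ _)))                   = s≤s (s≤s (s≤s z≤n))

  leaf-leaf-minimal : ∀ {x l y m n} (≡? : Dec (x ≡ y × l ≡ m)) →
                      Walk Adj (leaf x l) (leaf y m) n → (if does ≡? then 0 else 2) ≤ n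
  leaf-leaf-minimal (yes _) _                     = z≤n
  leaf-leaf-minimal (no  ≢) stop                  = contradiction (refl , refl) ≢
  leaf-leaf-minimal (no  _) (step (inj₁ ()) stop)
  leaf-leaf-minimal (no  _) (step (inj₂ ()) stop)
  leaf-leaf-minimal (no  _) (step _ (step _ _))   = s≤s (s≤s z≤n)

  dist-minimal : ∀ {u v n} → Walk Adj u v n → dist u v ≤ n
  dist-minimal {low _}                 = layer-walk
  dist-minimal {mid _}    {low _}      = layer-walk
  dist-minimal {leaf _ _} {low _}      = layer-walk
  dist-minimal {mid a}    {mid b}      = mid-mid-minimal (a ≟ b)
  dist-minimal {mid a}    {leaf x n}   = mid-leaf-minimal (a ∈? parents x n)
  dist-minimal {leaf x n} {mid a}      = mid-leaf-minimal (a ∈? parents x n) ∘ reverse Sum.swap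
  dist-minimal {leaf x m} {leaf y n}   = leaf-leaf-minimal ((x ≟ y) ×-dec (m ≟ n))

  graph : LayeredGraph (2 + k)
  graph = record
    { Node          = Node
    ; Adj           = Adj
    ; Adj-sym       = Sum.swap
    ; layer         = layer
    ; layer≤D       = λ where
        (low i)    → ≤-trans (toℕ≤pred[n] i) (≤-trans (n≤1+n k) (n≤1+n _))
        (mid _)    → n≤1+n _
        (leaf _ _) → ≤-refl
    ; Adj-layers    = Sum.map layer-Parent layer-Parent
    ; source        = source
    ; layer-source  = refl
    ; source-unique = source-unique
    ; parent        = λ v v≢s → case parent-of v v≢s of λ where
        (u , p) → u , inj₁ p , layer-Parent p
    ; dist          = dist
    ; dist-walk     = dist-walk
    ; dist-minimal  = dist-minimal
    }

-- The adversary and its rounds.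

module Adversary (k : ℕ) (A : OnlineAlgorithm (WideGraph.graph k))
                 (isMOO : IsMOO (WideGraph.graph k) A) where
  open WideGraph k
  open InfiniteServer graph hiding (OnlineAlgorithm; IsMOO; Competitive)
  open LayeredGraph graph using (AwayEdge)
  open Metric graph using (layer+dist≤layer)
  open Servers graph
  open MOO A isMOO
  open OnlineAlgorithm A

  -- An over-approximation of where MOO can have servers. `mid 0` and the low nodes other than the
  -- source are absent because they are never requested.
  data Used (m l : ℕ) : Node → Set where
    at-source : Used m l source
    at-mid    : ∀ {a} → 1 ≤ a → a ≤ m → Used m l (mid a)
    at-leaf   : ∀ {x n} → n ℕ.< l → Used m l (leaf x n)

  Used-mono : ∀ {m m′ l l′ u} → m ≤ m′ → l ≤ l′ → Used m l u → Used m′ l′ u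
  Used-mono m≤ l≤ at-source        = at-source
  Used-mono m≤ l≤ (at-mid 1≤a a≤m) = at-mid 1≤a (≤-trans a≤m m≤)
  Used-mono m≤ l≤ (at-leaf n<l)    = at-leaf (≤-trans n<l l≤)

  outward⇒layer≤ : ∀ {u v} → Star AwayEdge u v → layer u ≤ layer v
  outward⇒layer≤ path = ≤-trans (m≤m+n _ _) (layer+dist≤layer path)

  -- The source is the only used node in a layer below the mids.
  outward-to-mid : ∀ {m l u a} → Used m l u → Star AwayEdge u (mid a) → u ≡ source ⊎ u ≡ mid a
  outward-to-mid at-source    _    = inj₁ refl
  outward-to-mid (at-mid _ _) ε    = inj₂ refl
  outward-to-mid (at-mid _ _) ((_ , eq) ◅ path) =
    contradiction (≤-trans (≤-reflexive (sym eq)) (outward⇒layer≤ path)) 1+n≰n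
  outward-to-mid (at-leaf _)  path = contradiction (outward⇒layer≤ path) 1+n≰n

  outward-to-leaf : ∀ {n u x} → Used n n u → Star AwayEdge u (leaf x n) →
                    u ≡ source ⊎ ∃[ a ] u ≡ mid a × 1 ≤ a × a ≤ n × a ∈ parents x n
  outward-to-leaf at-source _ = inj₁ refl
  outward-to-leaf (at-mid 1≤a a≤n) ((inj₁ (mid-leaf a∈) , _) ◅ ε) = inj₂ (_ , refl , 1≤a , a≤n , a∈)
  outward-to-leaf (at-mid _ _) ((_ , eq) ◅ (_ , eq′) ◅ path) =
    contradiction (≤-trans (≤-reflexive (sym (trans eq′ (cong suc eq)))) (outward⇒layer≤ path)) 1+n≰n
  -- The used leaves belong to earlier rounds, so the requested one is not among them.
  outward-to-leaf (at-leaf n<n) ε = contradiction n<n 1+n≰n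
  outward-to-leaf (at-leaf _) ((_ , eq) ◅ path) =
    contradiction (≤-trans (≤-reflexive (sym eq)) (outward⇒layer≤ path)) 1+n≰n

  dist-mid-leaf : ∀ {a x n} → a ∈ parents x n → dist (mid a) (leaf x n) ≡ 1
  dist-mid-leaf a∈ = cong (if_then 1 else 3) (dec-true (_ ∈? _) a∈)

  AllUsed : ℕ → ℕ → Requests → Set
  AllUsed m l σ = ∀ {u} → Occupied (config σ) u → Used m l u

  record FreshMid (m l : ℕ) (σ : Requests) (a : ℕ) : Set where
    field
      all-used : AllUsed m l (mid a ∷ σ)
      kept     : ∀ {u} → u ≢ source → Occupied (config σ) u → Occupied (config (mid a ∷ σ)) u
      paid     : ALG (mid a ∷ σ) ≡ ALG σ + suc k

  -- Since `mid a` is empty, the server has to come from the source. It pays the full layer `suc k`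
  -- and abandons no other node.
  request-mid : ∀ σ a {m m′ l} → AllUsed m l σ → m ≤ m′ → 1 ≤ a → a ≤ m′ →
                ¬ Occupied (config σ) (mid a) → FreshMid m′ l σ a
  request-mid σ a used m≤m′ 1≤a a≤m′ unocc with take-step σ (mid a)
  ... | stay eq _ = contradiction (subst (λ C → Occupied C _) eq (serves σ (mid a))) unocc
  ... | send i _ eq alg _ out with outward-to-mid (used (i , refl)) out
  ...   | inj₂ i↦a = contradiction (i , i↦a) unocc
  ...   | inj₁ i↦s = record
    { all-used = λ occ → case Occupied-move⁻ i (subst (λ C → Occupied C _) eq occ) of λ where
        (inj₁ occ′) → Used-mono m≤m′ ≤-refl (used occ′)
        (inj₂ refl) → at-mid 1≤a a≤m′
    ; kept     = λ u≢s occ → subst (λ C → Occupied C _) (sym eq)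
                                   (Occupied-move⁺ i occ λ i↦u → u≢s (trans (sym i↦u) i↦s))
    ; paid     = trans alg (cong (λ u → ALG σ + dist u (mid a)) i↦s)
    }

  record LeafRequested (n : ℕ) (σ : Requests) (x : ℕ) : Set where
    field
      {vacated} : ℕ
      split     : vacated ≡ x ⊎ vacated ≡ n
      all-used  : AllUsed n (suc n) (leaf x n ∷ σ)
      unocc     : ¬ Occupied (config (leaf x n ∷ σ)) (mid vacated)
      paid      : ALG (leaf x n ∷ σ) ≡ ALG σ + 1

  request-leaf : ∀ σ x {n} → AllUsed n n σ → Occupied (config σ) (mid x) → LeafRequested n σ x
  request-leaf σ x {n} used x-occ with take-step σ (leaf x n)
  ... | stay eq _ = case used (subst (λ C → Occupied C _) eq (serves σ (leaf x n))) of λ where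
          (at-leaf n<n) → contradiction n<n 1+n≰n
  ... | send i _ eq alg loc out with outward-to-leaf (used (i , refl)) out
  ...   | inj₁ i↦s with j , j↦x ← x-occ = contradiction through (loc j x≢s x≢leaf)
    where
    x≢s : config σ j ≢ config σ i
    x≢s j≡i = case trans (sym j↦x) (trans j≡i i↦s) of λ ()
    x≢leaf : config σ j ≢ leaf x n
    x≢leaf j↦leaf = case trans (sym j↦x) j↦leaf of λ ()
    through : dist (config σ i) (leaf x n) ≡ dist (config σ i) (config σ j) + dist (config σ j) (leaf x n)
    through rewrite i↦s | j↦x | dist-mid-leaf {x} {x} {n} (there (here refl)) = +-comm 1 (suc k)
  ...   | inj₂ (a , i↦a , 1≤a , a≤n , a∈) = record
    { split    = which a∈
    ; all-used = λ occ → case Occupied-move⁻ i (subst (λ C → Occupied C _) eq occ) of λ where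
        (inj₁ occ′) → Used-mono ≤-refl (n≤1+n n) (used occ′)
        (inj₂ refl) → at-leaf ≤-refl
    ; unocc    = λ occ → gone (subst (λ C → Occupied C _) eq occ)
    ; paid     = trans alg (trans (cong (λ u → ALG σ + dist u (leaf x n)) i↦a)
                                  (cong (ALG σ +_) (dist-mid-leaf a∈)))
    }
    where
    which : a ∈ parents x n → a ≡ x ⊎ a ≡ n
    which (here refl)                         = contradiction refl (<⇒≢ 1≤a ∘ sym)
    which (there (here a≡x))                  = inj₁ a≡x
    which (there (there (here a≡n)))          = inj₂ a≡n
    which (there (there (there (here refl)))) = contradiction a≤n 1+n≰n
    gone : ¬ Occupied (move (config σ) (i , leaf x n)) (mid a)
    gone (j , j↦a) with i ≟ j
    ... | yes refl = case trans (sym (move-moved (config σ) i _)) j↦a of λ ()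
    -- A second server at `mid a` would contradict `distinct`.
    ... | no  i≢j  = i≢j (distinct σ i j
      (trans i↦a (trans (sym j↦a) (move-other (config σ) i _ i≢j)))
      (λ i↦s → case trans (sym i↦a) i↦s of λ ()))

  -- The opening uses `mid 1` and `mid 2` and each round one new mid, so `n` is `2 + t`. A round
  -- costs MOO `1 + 2 * suc k`, that is `3 + 2 * k`; the term `2 * suc k` in `q≤` is OPT's cost for
  -- the opening. `schedule` only bounds the optimum from above.
  record Round (t : ℕ) : Set where
    n : ℕ
    n = 2 + t
    field
      σ        : Requests
      x        : ℕ
      1≤x      : 1 ≤ x
      x<n      : x ℕ.< n
      all-used : AllUsed n n σ
      x-occ    : Occupied (config σ) (mid x)
      ALG≥     : (3 + 2 * k) * t ≤ ALG σ
      C        : Config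
      q        : ℕ
      schedule : Schedule σ C q
      i j      : ℕ
      i≢j      : i ≢ j
      i↦x      : C i ≡ mid x
      j↦n      : C j ≡ mid n
      q≤       : q ≤ 2 * t + 2 * suc k

  first : Round 0
  first = record
    { σ        = mid 2 ∷ mid 1 ∷ []
    ; x        = 1
    ; 1≤x      = ≤-refl
    ; x<n      = ≤-refl
    ; all-used = Used-mono ≤-refl z≤n ∘ all-used R₂
    ; x-occ    = kept R₂ (λ ()) (serves [] (mid 1))
    ; ALG≥     = ≤-trans (≤-reflexive (*-zeroʳ (3 + 2 * k))) z≤n
    ; schedule = serve (serve start ((0 , mid 1) ∷ []) (0 , refl)) ((1 , mid 2) ∷ []) (1 , refl)
    ; i        = 0
    ; j        = 1
    ; i≢j      = λ ()
    ; i↦x      = refl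
    ; j↦n      = refl
    ; q≤       = ≤-reflexive (total k)
    }
    where
    open FreshMid
    used₀ : AllUsed 0 0 []
    used₀ (_ , refl) = at-source
    unused₁ : ¬ Occupied (config []) (mid 1)
    unused₁ occ = case used₀ occ of λ { (at-mid _ ()) }
    R₁ : FreshMid 1 0 [] 1
    R₁ = request-mid [] 1 used₀ z≤n ≤-refl ≤-refl unused₁
    unused₂ : ¬ Occupied (config (mid 1 ∷ [])) (mid 2)
    unused₂ occ = case all-used R₁ occ of λ { (at-mid _ (s≤s ())) }
    R₂ : FreshMid 2 0 (mid 1 ∷ []) 2
    R₂ = request-mid (mid 1 ∷ []) 2 (all-used R₁) (n≤1+n 1) (s≤s z≤n) ≤-refl unused₂
    total : ∀ k → 0 + (suc k + 0) + (suc k + 0) ≡ 2 * 0 + 2 * suc k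
    total = solve-∀

  next : ∀ {t} → Round t → Round (suc t)
  next {t} round = record
    { σ        = mid (suc n) ∷ mid vacated ∷ leaf x n ∷ σ
    ; x        = vacated
    ; 1≤x      = 1≤v
    ; x<n      = s≤s v≤n
    ; all-used = all-used R₃
    ; x-occ    = kept R₃ (λ ()) (serves (leaf x n ∷ σ) (mid vacated))
    ; ALG≥     = ALG≥′
    -- Server `l` goes to the leaf and then on to `mid (suc n)`, one edge each time; in between, `h`
    -- already stands at the vacated node and nothing moves.
    ; schedule = serve (serve (serve schedule ((l , leaf x n) ∷ []) (Occupied-moved C l _)) []
                              (h , C₁h↦v))
                       ((l , mid (suc n)) ∷ []) (Occupied-moved C₁ l _)
    ; i        = h
    ; j        = l
    ; i≢j      = l≢h ∘ sym
    ; i↦x      = trans (move-other C₁ l _ l≢h) C₁h↦v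
    ; j↦n      = move-moved C₁ l _
    ; q≤       = q≤′
    }
    where
    open Round round hiding (all-used)
    open LeafRequested (request-leaf σ x (Round.all-used round) x-occ)
      renaming (all-used to all-used₁; paid to paid₁)
    open FreshMid
    1≤v : 1 ≤ vacated
    1≤v with split
    ... | inj₁ v≡x = subst (1 ≤_) (sym v≡x) 1≤x
    ... | inj₂ v≡n = subst (1 ≤_) (sym v≡n) (s≤s z≤n)
    v≤n : vacated ≤ n
    v≤n with split
    ... | inj₁ v≡x = subst (_≤ n) (sym v≡x) (<⇒≤ x<n)
    ... | inj₂ v≡n = ≤-reflexive v≡n
    σ₂ : Requests
    σ₂ = mid vacated ∷ leaf x n ∷ σ
    R₂ : FreshMid n (suc n) (leaf x n ∷ σ) vacated
    R₂ = request-mid (leaf x n ∷ σ) vacated all-used₁ ≤-refl 1≤v v≤n unocc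
    unused : ¬ Occupied (config σ₂) (mid (suc n))
    unused occ = case all-used R₂ occ of λ { (at-mid _ 1+n≤n) → 1+n≰n 1+n≤n }
    R₃ : FreshMid (suc n) (suc n) σ₂ (suc n)
    R₃ = request-mid σ₂ (suc n) (all-used R₂) (n≤1+n n) (s≤s z≤n) ≤-refl unused
    ALG≥′ : (3 + 2 * k) * suc t ≤ ALG (mid (suc n) ∷ σ₂)
    ALG≥′ = begin
      (3 + 2 * k) * suc t                  ≡⟨ increment k t ⟩
      (3 + 2 * k) * t + 1 + suc k + suc k  ≤⟨ +-monoˡ-≤ _ (+-monoˡ-≤ _ (+-monoˡ-≤ 1 ALG≥)) ⟩
      ALG σ + 1 + suc k + suc k            ≡⟨ cong (λ c → c + suc k + suc k) paid₁ ⟨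
      ALG (leaf x n ∷ σ) + suc k + suc k   ≡⟨ cong (_+ suc k) (paid R₂) ⟨
      ALG σ₂ + suc k                       ≡⟨ paid R₃ ⟨
      ALG (mid (suc n) ∷ σ₂)               ∎
      where
      open ≤-Reasoning
      increment : ∀ k t → (3 + 2 * k) * suc t ≡ (3 + 2 * k) * t + 1 + suc k + suc k
      increment = solve-∀
    -- `h` is OPT's server at the node that MOO left, `l` its server at the other of `mid x` and
    -- `mid n`.
    OPT-servers : ∃[ h ] ∃[ l ] l ≢ h × C h ≡ mid vacated × dist (C l) (leaf x n) ≡ 1
    OPT-servers with split
    ... | inj₁ v≡x = i , j , i≢j ∘ sym , trans i↦x (cong mid (sym v≡x)) ,
                     trans (cong (λ u → dist u (leaf x n)) j↦n)
                           (dist-mid-leaf {n} {x} {n} (there (there (here refl))))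
    ... | inj₂ v≡n = j , i , i≢j , trans j↦n (cong mid (sym v≡n)) ,
                     trans (cong (λ u → dist u (leaf x n)) i↦x)
                           (dist-mid-leaf {x} {x} {n} (there (here refl)))
    h l : ℕ
    h = proj₁ OPT-servers
    l = proj₁ (proj₂ OPT-servers)
    l≢h : l ≢ h
    l≢h = proj₁ (proj₂ (proj₂ OPT-servers))
    h↦v : C h ≡ mid vacated
    h↦v = proj₁ (proj₂ (proj₂ (proj₂ OPT-servers)))
    l→leaf : dist (C l) (leaf x n) ≡ 1
    l→leaf = proj₂ (proj₂ (proj₂ (proj₂ OPT-servers)))
    C₁ : Config
    C₁ = move C (l , leaf x n)
    C₁h↦v : C₁ h ≡ mid vacated
    C₁h↦v = trans (move-other C l _ l≢h) h↦v
    leaf→mid : dist (C₁ l) (mid (suc n)) ≡ 1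
    leaf→mid = trans (cong (λ u → dist u (mid (suc n))) (move-moved C l _))
                     (dist-mid-leaf {suc n} {x} {n} (there (there (there (here refl)))))
    q≤′ : q + (dist (C l) (leaf x n) + 0) + 0 + (dist (C₁ l) (mid (suc n)) + 0)
          ≤ 2 * suc t + 2 * suc k
    q≤′ rewrite l→leaf | leaf→mid = begin
      q + 1 + 0 + 1                    ≤⟨ +-monoˡ-≤ 1 (+-monoˡ-≤ 0 (+-monoˡ-≤ 1 q≤)) ⟩
      2 * t + 2 * suc k + 1 + 0 + 1    ≡⟨ increment t (suc k) ⟩
      2 * suc t + 2 * suc k            ∎
      where
      open ≤-Reasoning
      increment : ∀ t k → 2 * t + 2 * k + 1 + 0 + 1 ≡ 2 * suc t + 2 * k
      increment = solve-∀

  rounds : ∀ t → Round t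
  rounds zero    = first
  rounds (suc t) = next (rounds t)

-- From the invariants to the competitive ratio.

open import Data.Integer using (+_)

module _ {D : ℕ} (G : LayeredGraph D) where
  open InfiniteServer G hiding (OnlineAlgorithm; IsMOO; Competitive)

  -- Without deciding whether a cheaper schedule exists, well-founded descent yields an optimum up
  -- to double negation. That suffices for refuting competitiveness.
  ¬¬-optimum : ∀ {σ} q → ∃[ C ] Schedule σ C q → ¬ ¬ (∃[ opt ] IsOPT σ opt)
  ¬¬-optimum {σ} = <-rec (λ q → ∃[ C ] Schedule σ C q → ¬ ¬ (∃[ opt ] IsOPT σ opt))
    λ q cheaper s no-optimum →
      no-optimum (q , s , λ s′ → ≮⇒≥ λ m<q → cheaper m<q (_ , s′) no-optimum)

  competitive : 2 ≤ D → (A : OnlineAlgorithm G) → IsMOO G A → Competitive G A ((+ D / 1) - ½)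
  -- The charge vanishes in the initial configuration, so the additive constant is 0.
  competitive 2≤D A isMOO = 0ℚ , λ { σ opt ((_ , s) , _) →
    ℚ.≤-trans (2a+q≤2dq⇒a≤[d-½]q D (OnlineAlgorithm.ALG A σ) opt
                (UpperBound.2ALG+cost≤2Dcost 2≤D G A isMOO s))
              (ℚ.≤-reflexive (sym (ℚ.+-identityʳ _))) }

module _ (k : ℕ) (A : OnlineAlgorithm (WideGraph.graph k)) (isMOO : IsMOO (WideGraph.graph k) A) where
  open WideGraph k using (graph)
  open InfiniteServer graph hiding (OnlineAlgorithm; IsMOO; Competitive)
  open OnlineAlgorithm A
  open Adversary k A isMOO

  split : ∀ q → 2 * (2 + k) * q ≡ (3 + 2 * k) * q + q
  split = identity k
    where
    identity : ∀ k q → 2 * (2 + k) * q ≡ (3 + 2 * k) * q + q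
    identity = solve-∀

  -- The upper bound turned around: MOO pays at most `(3 + 2 * k) / 2` times the cost of any
  -- schedule, so the optimum grows with the number of rounds.
  ALG≥⇒≤cost : ∀ {σ C q} t → Schedule σ C q → (3 + 2 * k) * t ≤ ALG σ → t ≤ q
  ALG≥⇒≤cost {σ} {q = q} t s ALG≥ =
    ≤-trans (m≤m+n t _) (*-cancelˡ-≤ (3 + 2 * k) (+-cancelʳ-≤ q _ _ (begin
      (3 + 2 * k) * (2 * t) + q  ≡⟨ cong (_+ q) (exchange k t) ⟩
      2 * ((3 + 2 * k) * t) + q  ≤⟨ +-monoˡ-≤ q (*-monoʳ-≤ 2 ALG≥) ⟩
      2 * ALG σ + q              ≤⟨ UpperBound.2ALG+cost≤2Dcost (s≤s (s≤s z≤n)) graph A isMOO s ⟩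
      2 * (2 + k) * q            ≡⟨ split q ⟩
      (3 + 2 * k) * q + q        ∎)))
    where
    open ≤-Reasoning
    exchange : ∀ k t → (3 + 2 * k) * (2 * t) ≡ 2 * ((3 + 2 * k) * t)
    exchange = solve-∀

  -- For `D` equal to `2 + k`, the number `3 + 2 * k` is twice the ratio. The cost `2 * suc k` of
  -- the opening becomes the additive constant.
  ratio*cost≤ : ∀ {q} t → q ≤ 2 * t + 2 * suc k →
    (ι (2 + k) - ½) ℚ.* ι q ℚ.≤ ι ((3 + 2 * k) * t) ℚ.+ ι ((3 + 2 * k) * suc k)
  ratio*cost≤ {q} t q≤ = subst (_ ℚ.≤_) (ι-+ ((3 + 2 * k) * t) ((3 + 2 * k) * suc k))
    (2dq≤2a+q⇒[d-½]q≤a (2 + k) ((3 + 2 * k) * t + (3 + 2 * k) * suc k) q (begin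
      2 * (2 + k) * q                                        ≡⟨ split q ⟩
      (3 + 2 * k) * q + q                                    ≤⟨ +-monoˡ-≤ q (*-monoʳ-≤ (3 + 2 * k) q≤) ⟩
      (3 + 2 * k) * (2 * t + 2 * suc k) + q                  ≡⟨ cong (_+ q) (distribute k t) ⟩
      2 * ((3 + 2 * k) * t + (3 + 2 * k) * suc k) + q        ∎))
    where
    open ≤-Reasoning
    distribute : ∀ k t → (3 + 2 * k) * (2 * t + 2 * suc k) ≡ 2 * ((3 + 2 * k) * t + (3 + 2 * k) * suc k)
    distribute = solve-∀

  not-competitive : ∀ ρ → ρ < (+ (2 + k) / 1) - ½ → ¬ Competitive graph A ρ
  not-competitive ρ ρ<w (c , bound) =
    violated (eventually-exceeds ρ<w (ι ((3 + 2 * k) * suc k)) c)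
    where
    violated : ¬ (∃[ t ] ∀ {a q} → t ≤ q →
                  (ι (2 + k) - ½) ℚ.* ι q ℚ.≤ ι a ℚ.+ ι ((3 + 2 * k) * suc k) →
                  ¬ ι a ℚ.≤ ρ ℚ.* ι q ℚ.+ c)
    violated (t , exceeds) = ¬¬-optimum graph q (C , schedule) λ (opt , isOPT) →
      -- The optimum enters through two bounds: it is at least `t`, and at most the cost of the
      -- adversary's schedule.
      exceeds {(3 + 2 * k) * t} {opt}
        (ALG≥⇒≤cost t (proj₂ (proj₁ isOPT)) ALG≥)
        (ratio*cost≤ t (≤-trans (proj₂ isOPT schedule) q≤))
        (ℚ.≤-trans (ι-mono-≤ ALG≥) (bound σ opt isOPT))
      where open Round (rounds t)

theorem7 : (D : ℕ) → 2 ≤ D →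
    (MOO : (G : LayeredGraph D) → OnlineAlgorithm G) →
    ((G : LayeredGraph D) → IsMOO G (MOO G)) →
    ((G : LayeredGraph D) → Competitive G (MOO G) ((+ D / 1) - ½)) ×
    ((ρ : ℚ) → ρ < (+ D / 1) - ½ →
      Σ[ G ∈ LayeredGraph D ] ¬ Competitive G (MOO G) ρ)
theorem7 1 (s≤s ())
theorem7 (suc (suc k)) 2≤D MOO isMOO =
  (λ G → competitive G 2≤D (MOO G) (isMOO G)) ,
  λ ρ ρ<w → graph , not-competitive k (MOO graph) (isMOO graph) ρ ρ<w
  where open WideGraph k using (graph)
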